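{- Over the field $GF(2)$ there is an absolute constant $C$ such that for every $n\ge 1$, every bilinear circuit over $GF(2)$ that computes the product of two $n\times n$ matrices has at least $3n^2 - C n^{5/3}$ product gates. Equivalently, the bilinear rank over $GF(2)$ of the $n^2$ bilinear forms $\{\sum_{k=1}^n x_{i,k}y_{k,j}\}_{1\le i,j\le n}$ is at least $3n^2 - Cn^{5/3}$.
   Context: The inputs are two $n\times n$ matrices of variables $x=(x_{i,j})$, $y=(y_{i,j})$, and the $n^2$ outputs are the entries $(x\cdot y)_{i,j}=\sum_{k=1}^n x_{i,k}y_{k,j}$. An arithmetic circuit over a field $F$ is a directed acyclic graph whose in-degree-0 nodes are labeled by input variables, whose edges are labeled by field constants, and whose other nodes are sum gates or product gates; a node computes the sum (resp. product) of the values of its in-neighbours, each multiplied by the constant on the connecting edge. A bilinear circuit is an arithmetic circuit in which every product gate multiplies exactly two linear forms, the first a linear form in the variables of $x$ only and the second a linear form in the variables of $y$ only. The bilinear rank of a set of bilinear forms in $x,y$ is the smallest number of products $\mu(x)\eta(y)$ (with $\mu$ linear in $x$, $\eta$ linear in $y$) whose linear span contains all of the forms. -}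

module Defs where

open import Data.Bool using (Bool; true; false; _xor_; _∧_)
open import Data.Nat using (ℕ; zero; suc)
open import Data.Fin using (Fin; zero; suc; _≟_)
open import Data.Product using (Σ; ∃-syntax)
open import Relation.Nullary.Decidable using (⌊_⌋)
open import Relation.Binary.PropositionalEquality using (_≡_)

-- The field GF(2): Bool with addition = xor and multiplication = ∧.
GF2 : Set
GF2 = Bool

∑ : (r : ℕ) → (Fin r → GF2) → GF2
∑ zero    f = false
∑ (suc r) f = f zero xor ∑ r (λ t → f (suc t))

-- A linear form in the n×n matrix of variables x (resp. y):
-- L i k is the coefficient of x_{i,k} (resp. y_{i,k}).
LinearForm : ℕ → Set
LinearForm n = Fin n → Fin n → GF2

-- A bilinear form in x,y (x and y n×n matrices of variables):
-- B a b c d is the coefficient of the monomial x_{a,b} y_{c,d}.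
BilinearForm : ℕ → Set
BilinearForm n = Fin n → Fin n → Fin n → Fin n → GF2

prod : {n : ℕ} → LinearForm n → LinearForm n → BilinearForm n
prod μ η a b c d = μ a b ∧ η c d

-- The (i,j) entry of x·y: Σ_k x_{i,k} y_{k,j}.
-- Coefficient of x_{a,b} y_{c,d} is 1 iff a = i, b = c, d = j.
matMulEntry : {n : ℕ} → Fin n → Fin n → BilinearForm n
matMulEntry i j a b c d = ⌊ a ≟ i ⌋ ∧ (⌊ b ≟ c ⌋ ∧ ⌊ d ≟ j ⌋)

InSpanOfProducts : {n : ℕ} (r : ℕ) → (Fin r → LinearForm n) → (Fin r → LinearForm n)
                   → BilinearForm n → Set
InSpanOfProducts {n} r μ η B =
  Σ (Fin r → GF2) λ γ → (∀ a b c d → ∑ r (λ t → γ t ∧ prod (μ t) (η t) a b c d) ≡ B a b c d)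

-- The r products μ_t(x) η_t(y) span all n² entries of x·y,
-- i.e. they witness bilinear rank ≤ r for n×n matrix multiplication over GF(2).
SpansMatMul : (n r : ℕ) → (Fin r → LinearForm n) → (Fin r → LinearForm n) → Set
SpansMatMul n r μ η = ∀ i j → InSpanOfProducts r μ η (matMulEntry i j)

{-# OPTIONS --safe #-}
module Submission where

-- Write Γ_t(Z) for the coefficient of the t-th product in Σ z_ij (xy)_ij.  If m
-- rows of Z are independent, then Γ(Z) ∈ GF(2)^r has weight at least m n.  Pick
-- n² coordinates t on which Γ is bijective.  Requiring that all nonzero
-- combinations of k matrices have their first m = n − k rows independent is
-- implied by the nonvanishing of a product of minors, a polynomial of degree at
-- most 2ᵏ m, which is not the zero function because of the first k powers of the
-- nilpotent shift.  A nonzero polynomial over GF(2) does not vanish at some point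
-- of weight at most its degree; so there are k such matrices on which all but
-- 2ᵏ m of the n² chosen coordinates vanish.  They span a code of length at most
-- r − n² + 2ᵏ m, dimension k and distance at least m n, and the Plotkin bound
-- gives 2 (1 − 2⁻ᵏ) m n ≤ r − n² + 2ᵏ m.  Finally take 2ᵏ of the order of n^{1/3}.

open import Defs
open import Data.Bool as Bool using (Bool; true; false; not; _∧_; _∨_; _xor_)
open import Data.Bool.Properties using (∧-comm; ∧-assoc; ∧-identityʳ; ∧-zeroʳ; xor-assoc; xor-same; xor-identityʳ; ¬-not)
open import Data.Bool.Solver using (module xor-∧-Solver)
open import Data.Empty using (⊥-elim)
open import Data.Fin using (Fin; zero; suc; toℕ; _≟_; inject≤; _↑ˡ_; _↑ʳ_; combine; remQuot; punchIn; punchOut)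
open import Data.Fin.Properties using (any?; suc-injective; toℕ-inject≤; remQuot-combine; combine-remQuot; punchIn-punchOut; punchOut-injective)
open import Data.Nat using (ℕ; zero; suc; _+_; _*_; _^_; _∸_; _≤_; _<_; _<?_; NonZero; >-nonZero; z≤n; s≤s)
open import Data.Nat.Properties using (module ≤-Reasoning; +-0-commutativeMonoid; +-suc; +-comm; +-assoc; +-mono-≤; +-monoˡ-≤; +-monoʳ-≤; *-mono-≤; *-monoˡ-≤; *-monoʳ-≤; *-distribˡ-+; *-identityˡ; *-identityʳ; *-zeroʳ; ≤-reflexive; ≤-trans; m≤m+n; m≤n+m; m^n>0; m^n≢0; +-identityʳ; m≤n⇒m≤1+n; ≮⇒≥; ≤-<-trans; ^-monoˡ-<; ^-monoˡ-≤; ^-monoʳ-<; n<1+n; +-cancelˡ-≤; *-cancelʳ-≤; *-assoc; m≤n*m; m≤m*n; m∸n+n≡m; *-distribˡ-∸; m≤n+o⇒m∸n≤o)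
open import Data.Nat.Solver using (module +-*-Solver)
open import Algebra.Properties.CommutativeMonoid.Sum +-0-commutativeMonoid using (sum; sum-cong-≗; sum-remove; ∑-distrib-+; ∑-comm)
open import Data.Product using (∃-syntax; _×_; _,_; proj₁; proj₂)
open import Data.Sum using (_⊎_; inj₁; inj₂)
open import Data.Unit using (⊤; tt)
open import Data.Vec using (Vec; []; _∷_; lookup; replicate; tabulate)
open import Data.Vec.Properties using (lookup∘tabulate)
open import Function using (case_of_)
open import Relation.Nullary using (yes; no)
open import Relation.Nullary.Decidable using (⌊_⌋)
open import Relation.Binary.PropositionalEquality using (_≡_; _≢_; refl; sym; trans; cong; cong₂; subst; module ≡-Reasoning)
open xor-∧-Solver using (solve; _:+_; _:*_; _:=_; con)
open +-*-Solver using () renaming (solve to solveℕ; _:+_ to _⊕_; _:*_ to _⊗_; _:=_ to _⊜_; _:^_ to _⊛_; con to conℕ)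

-- Matrices and finite sums over GF(2)

Matrix : ℕ → ℕ → Set
Matrix p q = Fin p → Fin q → GF2

∑-cong : ∀ {r} {f g : Fin r → GF2} → (∀ t → f t ≡ g t) → ∑ r f ≡ ∑ r g
∑-cong {zero}  f≗g = refl
∑-cong {suc r} f≗g = cong₂ _xor_ (f≗g zero) (∑-cong (λ t → f≗g (suc t)))

∑-zero : ∀ {r} {f : Fin r → GF2} → (∀ t → f t ≡ false) → ∑ r f ≡ false
∑-zero {zero}  f≗0 = refl
∑-zero {suc r} f≗0 = cong₂ _xor_ (f≗0 zero) (∑-zero (λ t → f≗0 (suc t)))

∑-xor : ∀ {r} (f g : Fin r → GF2) → ∑ r (λ t → f t xor g t) ≡ ∑ r f xor ∑ r g
∑-xor {zero}  f g = refl
∑-xor {suc r} f g = trans (cong ((f zero xor g zero) xor_) (∑-xor (λ t → f (suc t)) (λ t → g (suc t))))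
  (solve 4 (λ a b c d → (a :+ b) :+ (c :+ d) := (a :+ c) :+ (b :+ d)) refl (f zero) (g zero) _ _)

∑-∧ˡ : ∀ {r} a (f : Fin r → GF2) → ∑ r (λ t → a ∧ f t) ≡ a ∧ ∑ r f
∑-∧ˡ false f = ∑-zero {f = λ t → false ∧ f t} (λ t → refl)
∑-∧ˡ true  f = refl

∑-∧ʳ : ∀ {r} (f : Fin r → GF2) a → ∑ r (λ t → f t ∧ a) ≡ ∑ r f ∧ a
∑-∧ʳ f a = trans (∑-cong (λ t → ∧-comm (f t) a)) (trans (∑-∧ˡ a f) (∧-comm a _))

∑-swap : ∀ {p q} (f : Fin p → Fin q → GF2) →
         ∑ p (λ i → ∑ q (λ j → f i j)) ≡ ∑ q (λ j → ∑ p (λ i → f i j))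
∑-swap {zero}  {q} f = sym (∑-zero {f = λ (_ : Fin q) → false} (λ _ → refl))
∑-swap {suc p} {q} f = trans (cong (∑ q (f zero) xor_) (∑-swap (λ i → f (suc i))))
  (sym (∑-xor (f zero) (λ j → ∑ p (λ i → f (suc i) j))))

∑-split : ∀ p q (f : Fin (p + q) → GF2) →
          ∑ (p + q) f ≡ ∑ p (λ i → f (i ↑ˡ q)) xor ∑ q (λ j → f (p ↑ʳ j))
∑-split zero    q f = refl
∑-split (suc p) q f = trans (cong (f zero xor_) (∑-split p q (λ i → f (suc i)))) (sym (xor-assoc (f zero) _ _))

∑-combine : ∀ p q (f : Fin (p * q) → GF2) →
            ∑ (p * q) f ≡ ∑ p (λ i → ∑ q (λ j → f (combine i j)))
∑-combine zero    q f = refl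
∑-combine (suc p) q f = trans (∑-split q (p * q) f)
  (cong (∑ q (λ j → f (j ↑ˡ (p * q))) xor_) (∑-combine p q (λ l → f (q ↑ʳ l))))

δ : ∀ {s} → Fin s → Fin s → GF2
δ i j = ⌊ i ≟ j ⌋

δ-refl : ∀ {s} (i : Fin s) → δ i i ≡ true
δ-refl i with i ≟ i
... | yes _ = refl
... | no i≢i = ⊥-elim (i≢i refl)

δ-suc : ∀ {s} (i j : Fin s) → δ (suc i) (suc j) ≡ δ i j
δ-suc i j with i ≟ j
... | yes _ = refl
... | no _  = refl

δ-sym : ∀ {s} (i j : Fin s) → δ i j ≡ δ j i
δ-sym i j with i ≟ j | j ≟ i
... | yes _ | yes _ = refl
... | no _  | no _  = refl
... | yes p | no ¬p = ⊥-elim (¬p (sym p))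
... | no ¬p | yes p = ⊥-elim (¬p (sym p))

∑-δʳ : ∀ {s} (f : Fin s → GF2) j → ∑ s (λ i → f i ∧ δ i j) ≡ f j
∑-δʳ f zero = trans (cong₂ _xor_ (∧-identityʳ (f zero)) (∑-zero (λ i → ∧-zeroʳ (f (suc i))))) (xor-identityʳ _)
∑-δʳ f (suc j) = trans
  (cong₂ _xor_ (∧-zeroʳ (f zero)) (∑-cong (λ i → cong (f (suc i) ∧_) (δ-suc i j))))
  (∑-δʳ (λ i → f (suc i)) j)

∑-δˡ : ∀ {s} (f : Fin s → GF2) j → ∑ s (λ i → δ j i ∧ f i) ≡ f j
∑-δˡ f j = trans (∑-cong (λ i → trans (∧-comm (δ j i) (f i)) (cong (f i ∧_) (δ-sym j i)))) (∑-δʳ f j)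

-- Associativity (uA)v = u(Av) for a row u and a column v; most later manipulations of codes and
-- inverses are instances of it.
∑-assoc : ∀ {p q} (u : Fin p → GF2) (A : Matrix p q) (v : Fin q → GF2) →
          ∑ q (λ j → ∑ p (λ i → u i ∧ A i j) ∧ v j) ≡ ∑ p (λ i → u i ∧ ∑ q (λ j → A i j ∧ v j))
∑-assoc {p} {q} u A v = begin
  ∑ q (λ j → ∑ p (λ i → u i ∧ A i j) ∧ v j)    ≡⟨ ∑-cong (λ j → sym (∑-∧ʳ (λ i → u i ∧ A i j) (v j))) ⟩
  ∑ q (λ j → ∑ p (λ i → (u i ∧ A i j) ∧ v j))  ≡⟨ ∑-swap (λ j i → (u i ∧ A i j) ∧ v j) ⟩
  ∑ p (λ i → ∑ q (λ j → (u i ∧ A i j) ∧ v j))  ≡⟨ ∑-cong (λ i → ∑-cong (λ j → ∧-assoc (u i) (A i j) (v j))) ⟩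
  ∑ p (λ i → ∑ q (λ j → u i ∧ (A i j ∧ v j)))  ≡⟨ ∑-cong (λ i → ∑-∧ˡ (u i) (λ j → A i j ∧ v j)) ⟩
  ∑ p (λ i → u i ∧ ∑ q (λ j → A i j ∧ v j))    ∎
  where open ≡-Reasoning

-- Gaussian elimination

infixl 7 _·_
_·_ : ∀ {p q s} → Matrix p q → Matrix q s → Matrix p s
_·_ {q = q} A B i k = ∑ q (λ j → A i j ∧ B j k)

record Inverses {s} (P H : Matrix s s) : Set where
  field
    right : ∀ i k → (P · H) i k ≡ δ i k
    left  : ∀ i k → (H · P) i k ≡ δ i k

RowsIndependent : ∀ {s r} → Matrix s r → Set
RowsIndependent {s} G = ∀ (c : Fin s → GF2) → (∀ t → ∑ s (λ l → c l ∧ G l t) ≡ false) → ∀ l → c l ≡ false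

-- Full row rank in a form without determinants: a choice of s columns with an explicit two-sided
-- inverse. Its rows later provide the basis dual to the chosen coordinates.
record InvertibleMinor {s r} (G : Matrix s r) : Set where
  field
    column   : Fin s → Fin r
    inverse  : Matrix s s
    inverses : Inverses (λ l j → G l (column j)) inverse

  open Inverses inverses public

  -- If columns i ≠ j coincided, then in the product of `inverse` and the minor the entry (i, j),
  -- which is 0, would equal the entry (i, i), which is 1.
  column-injective : ∀ {i j} → column i ≡ column j → i ≡ j
  column-injective {i} {j} eq with i ≟ j in i≟j
  ... | yes i≡j = i≡j
  ... | no _ = case trans (sym (cong ⌊_⌋ i≟j)) (trans (sym (left i j))
                 (trans (∑-cong (λ l → cong (λ t → inverse i l ∧ G l t) (sym eq)))
                 (trans (left i i) (δ-refl i)))) of λ ()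

-- The inverse of [[1, p], [q, P + qp]] is [[1 + pHq, pH], [Hq, H]] when P H = 1.
module _ {s} (P H R : Matrix s s) (p q : Fin s → GF2)
         (inv : Inverses P H) (R≡ : ∀ l j → P l j ≡ R l j xor (q l ∧ p j)) where
  open Inverses inv
  open ≡-Reasoning

  private
    pH Hq : Fin s → GF2
    pH k = ∑ s (λ j → p j ∧ H j k)
    Hq l = ∑ s (λ j → H l j ∧ q j)

    pHq : GF2
    pHq = ∑ s (λ j → p j ∧ Hq j)

  bordered borderedInverse : Matrix (suc s) (suc s)
  bordered zero    zero    = true
  bordered zero    (suc j) = p j
  bordered (suc l) zero    = q l
  bordered (suc l) (suc j) = R l j

  borderedInverse zero    zero    = true xor pHq
  borderedInverse zero    (suc k) = pH k
  borderedInverse (suc l) zero    = Hq l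
  borderedInverse (suc l) (suc k) = H l k

  private
    R≡′ : ∀ l j → R l j ≡ P l j xor (q l ∧ p j)
    R≡′ l j = trans (solve 2 (λ a b → a := (a :+ b) :+ b) refl (R l j) (q l ∧ p j))
                    (cong (_xor (q l ∧ p j)) (sym (R≡ l j)))

    R∙ : ∀ l (v : Fin s → GF2) → ∑ s (λ j → R l j ∧ v j)
                               ≡ ∑ s (λ j → P l j ∧ v j) xor (q l ∧ ∑ s (λ j → p j ∧ v j))
    R∙ l v = begin
      ∑ s (λ j → R l j ∧ v j)
        ≡⟨ ∑-cong (λ j → trans (cong (_∧ v j) (R≡′ l j))
             (solve 4 (λ a b c d → (a :+ b :* c) :* d := a :* d :+ b :* (c :* d)) refl (P l j) (q l) (p j) (v j))) ⟩
      ∑ s (λ j → (P l j ∧ v j) xor (q l ∧ (p j ∧ v j)))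
        ≡⟨ ∑-xor (λ j → P l j ∧ v j) (λ j → q l ∧ (p j ∧ v j)) ⟩
      ∑ s (λ j → P l j ∧ v j) xor ∑ s (λ j → q l ∧ (p j ∧ v j))
        ≡⟨ cong (∑ s (λ j → P l j ∧ v j) xor_) (∑-∧ˡ (q l) (λ j → p j ∧ v j)) ⟩
      ∑ s (λ j → P l j ∧ v j) xor (q l ∧ ∑ s (λ j → p j ∧ v j)) ∎

    ∙R : ∀ (v : Fin s → GF2) k → ∑ s (λ j → v j ∧ R j k)
                               ≡ ∑ s (λ j → v j ∧ P j k) xor (∑ s (λ j → v j ∧ q j) ∧ p k)
    ∙R v k = begin
      ∑ s (λ j → v j ∧ R j k)
        ≡⟨ ∑-cong (λ j → trans (cong (v j ∧_) (R≡′ j k))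
             (solve 4 (λ a b c d → d :* (a :+ b :* c) := d :* a :+ (d :* b) :* c) refl (P j k) (q j) (p k) (v j))) ⟩
      ∑ s (λ j → (v j ∧ P j k) xor ((v j ∧ q j) ∧ p k))
        ≡⟨ ∑-xor (λ j → v j ∧ P j k) (λ j → (v j ∧ q j) ∧ p k) ⟩
      ∑ s (λ j → v j ∧ P j k) xor ∑ s (λ j → (v j ∧ q j) ∧ p k)
        ≡⟨ cong (∑ s (λ j → v j ∧ P j k) xor_) (∑-∧ʳ (λ j → v j ∧ q j) (p k)) ⟩
      ∑ s (λ j → v j ∧ P j k) xor (∑ s (λ j → v j ∧ q j) ∧ p k) ∎

    PHq : ∀ l → ∑ s (λ j → P l j ∧ Hq j) ≡ q l
    PHq l = trans (sym (∑-assoc (P l) H q))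
              (trans (∑-cong (λ j → cong (_∧ q j) (right l j))) (∑-δˡ q l))

    pHP : ∀ k → ∑ s (λ j → pH j ∧ P j k) ≡ p k
    pHP k = trans (∑-assoc p H (λ j → P j k))
              (trans (∑-cong (λ j → cong (p j ∧_) (left j k))) (∑-δʳ p k))

  borderedInverses : Inverses bordered borderedInverse
  borderedInverses .Inverses.right zero zero =
    solve 1 (λ a → (con true :+ a) :+ a := con true) refl pHq
  borderedInverses .Inverses.right zero (suc k) = xor-same (pH k)
  borderedInverses .Inverses.right (suc l) zero = begin
    (q l ∧ (true xor pHq)) xor ∑ s (λ j → R l j ∧ Hq j)
      ≡⟨ cong ((q l ∧ (true xor pHq)) xor_) (trans (R∙ l Hq) (cong (_xor (q l ∧ pHq)) (PHq l))) ⟩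
    (q l ∧ (true xor pHq)) xor (q l xor (q l ∧ pHq))
      ≡⟨ solve 2 (λ a b → a :* (con true :+ b) :+ (a :+ a :* b) := con false) refl (q l) pHq ⟩
    false ∎
  borderedInverses .Inverses.right (suc l) (suc k) = begin
    (q l ∧ pH k) xor ∑ s (λ j → R l j ∧ H j k)
      ≡⟨ cong ((q l ∧ pH k) xor_) (trans (R∙ l (λ j → H j k)) (cong (_xor (q l ∧ pH k)) (right l k))) ⟩
    (q l ∧ pH k) xor (δ l k xor (q l ∧ pH k))
      ≡⟨ solve 2 (λ a b → a :+ (b :+ a) := b) refl (q l ∧ pH k) (δ l k) ⟩
    δ l k ≡⟨ δ-suc l k ⟨
    δ (suc l) (suc k) ∎
  borderedInverses .Inverses.left zero zero = begin
    ((true xor pHq) ∧ true) xor ∑ s (λ j → pH j ∧ q j)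
      ≡⟨ cong (((true xor pHq) ∧ true) xor_) (∑-assoc p H q) ⟩
    ((true xor pHq) ∧ true) xor pHq
      ≡⟨ solve 1 (λ a → (con true :+ a) :* con true :+ a := con true) refl pHq ⟩
    true ∎
  borderedInverses .Inverses.left zero (suc k) = begin
    ((true xor pHq) ∧ p k) xor ∑ s (λ j → pH j ∧ R j k)
      ≡⟨ cong (((true xor pHq) ∧ p k) xor_) (trans (∙R pH k) (cong₂ _xor_ (pHP k) (cong (_∧ p k) (∑-assoc p H q)))) ⟩
    ((true xor pHq) ∧ p k) xor (p k xor (pHq ∧ p k))
      ≡⟨ solve 2 (λ a b → (con true :+ b) :* a :+ (a :+ b :* a) := con false) refl (p k) pHq ⟩
    false ∎
  borderedInverses .Inverses.left (suc l) zero =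
    trans (cong (_xor Hq l) (∧-identityʳ (Hq l))) (xor-same (Hq l))
  borderedInverses .Inverses.left (suc l) (suc k) = begin
    (Hq l ∧ p k) xor ∑ s (λ j → H l j ∧ R j k)
      ≡⟨ cong ((Hq l ∧ p k) xor_) (trans (∙R (H l) k) (cong (_xor (Hq l ∧ p k)) (left l k))) ⟩
    (Hq l ∧ p k) xor (δ l k xor (Hq l ∧ p k))
      ≡⟨ solve 2 (λ a b → a :+ (b :+ a) := b) refl (Hq l ∧ p k) (δ l k) ⟩
    δ l k ≡⟨ δ-suc l k ⟨
    δ (suc l) (suc k) ∎

Inverses-resp : ∀ {s} {P Q H : Matrix s s} → (∀ i j → P i j ≡ Q i j) → Inverses P H → Inverses Q H
Inverses-resp {H = H} P≗Q inv = record
  { right = λ i k → trans (∑-cong (λ j → cong (_∧ H j k) (sym (P≗Q i j)))) (right i k)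
  ; left  = λ i k → trans (∑-cong (λ j → cong (H i j ∧_) (sym (P≗Q j k)))) (left i k)
  } where open Inverses inv

-- Induction on the number of rows. Independence forces an entry 1 in the first row, at t₀; clearing
-- column t₀ from the other rows leaves G′, and the minor found for G′ is bordered by the pivot row
-- and column.
invertibleMinor : ∀ {s r} (G : Matrix s r) → RowsIndependent G → InvertibleMinor G
invertibleMinor {zero} G _ = record
  { column = λ () ; inverse = λ () ; inverses = record { right = λ () ; left = λ () } }
invertibleMinor {suc s} {r} G indep with any? (λ t → G zero t Bool.≟ true)
... | no row≡0 = case indep (δ zero) e₀G≡0 zero of λ ()
  where
  e₀G≡0 : ∀ t → ∑ (suc s) (λ l → δ zero l ∧ G l t) ≡ false
  e₀G≡0 t = trans (∑-δˡ (λ l → G l t) zero) (¬-not (λ Gt → row≡0 (t , Gt)))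
... | yes (t₀ , pivot) = record
  { column   = column′
  ; inverse  = borderedInverse P H R p q inverses R≡
  ; inverses = Inverses-resp bordered≗ (borderedInverses P H R p q inverses R≡)
  }
  where
  G′ : Matrix s r
  G′ l t = G (suc l) t xor (G (suc l) t₀ ∧ G zero t)

  indep′ : RowsIndependent G′
  -- A relation c among the rows of G′ lifts to one among the rows of G: the first row gets the sum
  -- of all its multiples that were added to the others.
  indep′ c cG′≡0 l = indep (λ { zero → ∑ s (λ l → c l ∧ G (suc l) t₀) ; (suc l) → c l }) cG≡0 (suc l)
    where
    open ≡-Reasoning
    cG≡0 : ∀ t → (∑ s (λ l → c l ∧ G (suc l) t₀) ∧ G zero t) xor ∑ s (λ l → c l ∧ G (suc l) t) ≡ false
    cG≡0 t = begin
      (∑ s (λ l → c l ∧ G (suc l) t₀) ∧ G zero t) xor ∑ s (λ l → c l ∧ G (suc l) t)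
        ≡⟨ cong (_xor _) (∑-∧ʳ (λ l → c l ∧ G (suc l) t₀) (G zero t)) ⟨
      ∑ s (λ l → (c l ∧ G (suc l) t₀) ∧ G zero t) xor ∑ s (λ l → c l ∧ G (suc l) t)
        ≡⟨ ∑-xor (λ l → (c l ∧ G (suc l) t₀) ∧ G zero t) (λ l → c l ∧ G (suc l) t) ⟨
      ∑ s (λ l → ((c l ∧ G (suc l) t₀) ∧ G zero t) xor (c l ∧ G (suc l) t))
        ≡⟨ ∑-cong (λ l → solve 4 (λ x a b y → (x :* a) :* b :+ x :* y := x :* (y :+ a :* b)) refl
                           (c l) (G (suc l) t₀) (G zero t) (G (suc l) t)) ⟩
      ∑ s (λ l → c l ∧ G′ l t) ≡⟨ cG′≡0 t ⟩
      false ∎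

  open InvertibleMinor (invertibleMinor G′ indep′) renaming (inverse to H)

  P R : Matrix s s
  P l j = G′ l (column j)
  R l j = G (suc l) (column j)

  p q : Fin s → GF2
  p j = G zero (column j)
  q l = G (suc l) t₀

  R≡ : ∀ l j → P l j ≡ R l j xor (q l ∧ p j)
  R≡ l j = refl

  column′ : Fin (suc s) → Fin r
  column′ zero    = t₀
  column′ (suc j) = column j

  bordered≗ : ∀ i j → bordered P H R p q inverses R≡ i j ≡ G i (column′ j)
  bordered≗ zero    zero    = sym pivot
  bordered≗ zero    (suc j) = refl
  bordered≗ (suc l) zero    = refl
  bordered≗ (suc l) (suc j) = refl

-- Boolean polynomials of bounded degree

-- The multilinear polynomial of f has degree less than d.
DegreeBelow : (m d : ℕ) → (Vec Bool m → Bool) → Set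
DegreeBelow m       zero    f = ∀ v → f v ≡ false
DegreeBelow zero    (suc d) f = ⊤
DegreeBelow (suc m) (suc d) f =
  DegreeBelow m (suc d) (λ v → f (false ∷ v)) ×
  DegreeBelow m d (λ v → f (true ∷ v) xor f (false ∷ v))

deg-cong : ∀ m d {f g} → (∀ v → f v ≡ g v) → DegreeBelow m d f → DegreeBelow m d g
deg-cong m       zero    f≗g f≗0 v     = trans (sym (f≗g v)) (f≗0 v)
deg-cong zero    (suc d) f≗g _         = tt
deg-cong (suc m) (suc d) f≗g (f₀ , Δf) =
  deg-cong m (suc d) (λ v → f≗g (false ∷ v)) f₀ ,
  deg-cong m d (λ v → cong₂ _xor_ (f≗g (true ∷ v)) (f≗g (false ∷ v))) Δf

deg-zero : ∀ m d → DegreeBelow m d (λ _ → false)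
deg-zero m       zero    v = refl
deg-zero zero    (suc d)   = tt
deg-zero (suc m) (suc d)   = deg-zero m (suc d) , deg-zero m d

deg-suc : ∀ m d {f} → DegreeBelow m d f → DegreeBelow m (suc d) f
deg-suc m       zero    f≗0       = deg-cong m 1 (λ v → sym (f≗0 v)) (deg-zero m 1)
deg-suc zero    (suc d) _         = tt
deg-suc (suc m) (suc d) (f₀ , Δf) = deg-suc m (suc d) f₀ , deg-suc m d Δf

deg-xor : ∀ m d {f g} → DegreeBelow m d f → DegreeBelow m d g → DegreeBelow m d (λ v → f v xor g v)
deg-xor m       zero    f≗0 g≗0 v = cong₂ _xor_ (f≗0 v) (g≗0 v)
deg-xor zero    (suc d) _   _     = tt
deg-xor (suc m) (suc d) {f} {g} (f₀ , Δf) (g₀ , Δg) =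
  deg-xor m (suc d) f₀ g₀ ,
  deg-cong m d (λ v → solve 4 (λ a b c e → (a :+ b) :+ (c :+ e) := (a :+ c) :+ (b :+ e)) refl
                        (f (true ∷ v)) (f (false ∷ v)) (g (true ∷ v)) (g (false ∷ v)))
           (deg-xor m d Δf Δg)

deg-const : ∀ m d b → DegreeBelow m (suc d) (λ _ → b)
deg-const zero    d b = tt
deg-const (suc m) d b = deg-const m d b , deg-cong m d (λ _ → sym (xor-same b)) (deg-zero m d)

deg-lookup : ∀ {m} (i : Fin m) → DegreeBelow m 2 (λ v → lookup v i)
deg-lookup {suc m} zero    = deg-zero m 2 , deg-const m 0 true
deg-lookup {suc m} (suc i) = deg-lookup i , deg-cong m 1 (λ v → sym (xor-same (lookup v i))) (deg-zero m 1)

-- Product rule: with F₀, G₀ the restrictions to a first variable 0 and ΔF, ΔG the differences, the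
-- difference of f g is ΔF G₀ + F₀ ΔG + ΔF ΔG. The bounds are strict, so `suc d` and `suc e` stand
-- for degrees at most d and e; a factor of degree below 0 is identically zero and is treated
-- separately.
deg-∧ : ∀ m d e {f g} → DegreeBelow m (suc d) f → DegreeBelow m (suc e) g →
        DegreeBelow m (suc (d + e)) (λ v → f v ∧ g v)
deg-∧ zero    d e _ _ = tt
deg-∧ (suc m) d e {f} {g} (f₀ , Δf) (g₀ , Δg) =
  deg-∧ m d e f₀ g₀ ,
  deg-cong m (d + e)
    (λ v → solve 4 (λ a b c h → ((a :+ b) :* h :+ b :* (c :+ h)) :+ (a :+ b) :* (c :+ h) := a :* c :+ b :* h) refl
             (f (true ∷ v)) (f (false ∷ v)) (g (true ∷ v)) (g (false ∷ v)))
    (deg-xor m (d + e) (deg-xor m (d + e) (first d Δf) (second e Δg)) (both d e Δf Δg))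
  where
  F₀ ΔF G₀ ΔG : Vec Bool m → Bool
  F₀ v = f (false ∷ v)
  ΔF v = f (true ∷ v) xor f (false ∷ v)
  G₀ v = g (false ∷ v)
  ΔG v = g (true ∷ v) xor g (false ∷ v)

  first : ∀ d → DegreeBelow m d ΔF → DegreeBelow m (d + e) (λ v → ΔF v ∧ G₀ v)
  first zero    Δf = deg-cong m e (λ v → cong (_∧ G₀ v) (sym (Δf v))) (deg-zero m e)
  first (suc d) Δf = deg-∧ m d e Δf g₀

  second : ∀ e → DegreeBelow m e ΔG → DegreeBelow m (d + e) (λ v → F₀ v ∧ ΔG v)
  second zero    Δg = deg-cong m (d + 0) (λ v → sym (trans (cong (F₀ v ∧_) (Δg v)) (∧-zeroʳ (F₀ v)))) (deg-zero m (d + 0))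
  second (suc e) Δg = subst (λ k → DegreeBelow m k (λ v → F₀ v ∧ ΔG v)) (sym (+-suc d e)) (deg-∧ m d e f₀ Δg)

  both : ∀ d e → DegreeBelow m d ΔF → DegreeBelow m e ΔG → DegreeBelow m (d + e) (λ v → ΔF v ∧ ΔG v)
  both zero    e       Δf Δg = deg-cong m e (λ v → cong (_∧ ΔG v) (sym (Δf v))) (deg-zero m e)
  both (suc d) zero    Δf Δg = deg-cong m (suc d + 0) (λ v → sym (trans (cong (ΔF v ∧_) (Δg v)) (∧-zeroʳ (ΔF v)))) (deg-zero m (suc d + 0))
  both (suc d) (suc e) Δf Δg = subst (λ k → DegreeBelow m k (λ v → ΔF v ∧ ΔG v)) (sym (cong suc (+-suc d e)))
                                 (deg-suc m (suc (d + e)) (deg-∧ m d e Δf Δg))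

deg-∑ : ∀ m d {r} {f : Fin r → Vec Bool m → Bool} →
        (∀ t → DegreeBelow m d (f t)) → DegreeBelow m d (λ v → ∑ r (λ t → f t v))
deg-∑ m d {zero}  fs = deg-zero m d
deg-∑ m d {suc r} fs = deg-xor m d (fs zero) (deg-∑ m d (λ t → fs (suc t)))

weight : ∀ {m} → Vec Bool m → ℕ
weight []          = 0
weight (false ∷ v) = weight v
weight (true  ∷ v) = suc (weight v)

-- If f vanishes whenever the first variable is 0, then at points with first variable 1 it equals
-- its difference, whose degree bound is one smaller. This pays for the extra unit of weight.
zeroOrLightPoint : ∀ m d f → DegreeBelow m d f →
                   (∀ v → f v ≡ false) ⊎ (∃[ v ] (weight v < d × f v ≡ true))
zeroOrLightPoint m zero f f≗0 = inj₁ f≗0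
zeroOrLightPoint zero (suc d) f _ with f [] in eq
... | true  = inj₂ ([] , s≤s z≤n , eq)
... | false = inj₁ (λ { [] → eq })
zeroOrLightPoint (suc m) (suc d) f (f₀ , Δf)
  with zeroOrLightPoint m (suc d) (λ v → f (false ∷ v)) f₀
... | inj₂ (v , light , fv) = inj₂ (false ∷ v , light , fv)
... | inj₁ f₀≗0 with zeroOrLightPoint m d (λ v → f (true ∷ v) xor f (false ∷ v)) Δf
...   | inj₂ (v , light , Δfv) = inj₂ (true ∷ v , s≤s light , trans (sym f₁≡Δf) Δfv)
  where
  f₁≡Δf : f (true ∷ v) xor f (false ∷ v) ≡ f (true ∷ v)
  f₁≡Δf = trans (cong (f (true ∷ v) xor_) (f₀≗0 v)) (xor-identityʳ _)
...   | inj₁ Δf≗0 = inj₁ λ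
  { (false ∷ v) → f₀≗0 v
  ; (true  ∷ v) → trans (sym (trans (cong (f (true ∷ v) xor_) (f₀≗0 v)) (xor-identityʳ _))) (Δf≗0 v) }

-- The exterior algebra in characteristic 2

-- An element of the exterior algebra on n generators is given by its
-- coefficients, indexed by sets of generators; in characteristic 2 this algebra
-- is commutative.
Exterior : ℕ → Set
Exterior n = Vec Bool n → GF2

𝟙 : ∀ {n} → Exterior n
𝟙 []          = true
𝟙 (false ∷ S) = 𝟙 S
𝟙 (true  ∷ S) = false

infixr 6 _⋀_
-- Left multiplication by a vector. A set that contains the first generator receives it either from
-- ω or from v; no signs are needed in characteristic 2.
_⋀_ : ∀ {n} → (Fin n → GF2) → Exterior n → Exterior n
(v ⋀ ω) []          = false
(v ⋀ ω) (false ∷ S) = ((λ k → v (suc k)) ⋀ (λ T → ω (false ∷ T))) S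
(v ⋀ ω) (true  ∷ S) = ((λ k → v (suc k)) ⋀ (λ T → ω (true ∷ T))) S xor (v zero ∧ ω (false ∷ S))

⋀-cong : ∀ {n} {v w : Fin n → GF2} {ω ξ : Exterior n} →
         (∀ k → v k ≡ w k) → (∀ S → ω S ≡ ξ S) → ∀ S → (v ⋀ ω) S ≡ (w ⋀ ξ) S
⋀-cong v≗w ω≗ξ []          = refl
⋀-cong v≗w ω≗ξ (false ∷ S) = ⋀-cong (λ k → v≗w (suc k)) (λ T → ω≗ξ (false ∷ T)) S
⋀-cong v≗w ω≗ξ (true  ∷ S) = cong₂ _xor_ (⋀-cong (λ k → v≗w (suc k)) (λ T → ω≗ξ (true ∷ T)) S)
                                         (cong₂ _∧_ (v≗w zero) (ω≗ξ (false ∷ S)))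

⋀-linearʳ : ∀ {n} (v : Fin n → GF2) (ω ξ : Exterior n) b S →
            (v ⋀ (λ T → ω T xor (b ∧ ξ T))) S ≡ (v ⋀ ω) S xor (b ∧ (v ⋀ ξ) S)
⋀-linearʳ v ω ξ b []          = sym (∧-zeroʳ b)
⋀-linearʳ v ω ξ b (false ∷ S) = ⋀-linearʳ _ (λ T → ω (false ∷ T)) (λ T → ξ (false ∷ T)) b S
⋀-linearʳ v ω ξ b (true  ∷ S) = trans
  (cong (_xor (v zero ∧ (ω (false ∷ S) xor (b ∧ ξ (false ∷ S))))) (⋀-linearʳ _ (λ T → ω (true ∷ T)) (λ T → ξ (true ∷ T)) b S))
  (solve 6 (λ p q b x o z → (p :+ b :* q) :+ x :* (o :+ b :* z) := (p :+ x :* o) :+ b :* (q :+ x :* z)) refl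
     (((λ k → v (suc k)) ⋀ (λ T → ω (true ∷ T))) S) (((λ k → v (suc k)) ⋀ (λ T → ξ (true ∷ T))) S)
     b (v zero) (ω (false ∷ S)) (ξ (false ∷ S)))

⋀-zeroʳ : ∀ {n} (v : Fin n → GF2) {ω : Exterior n} → (∀ S → ω S ≡ false) → ∀ S → (v ⋀ ω) S ≡ false
⋀-zeroʳ v ω≗0 []          = refl
⋀-zeroʳ v ω≗0 (false ∷ S) = ⋀-zeroʳ _ (λ T → ω≗0 (false ∷ T)) S
⋀-zeroʳ v ω≗0 (true  ∷ S) = cong₂ _xor_ (⋀-zeroʳ _ (λ T → ω≗0 (true ∷ T)) S)
                                        (trans (cong (v zero ∧_) (ω≗0 (false ∷ S))) (∧-zeroʳ (v zero)))

⋀-linearˡ : ∀ {m n} (x : Fin m → GF2) (M : Matrix m n) (ω : Exterior n) S →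
            ((λ k → ∑ m (λ a → x a ∧ M a k)) ⋀ ω) S ≡ ∑ m (λ a → x a ∧ (M a ⋀ ω) S)
⋀-linearˡ x M ω []          = sym (∑-zero (λ a → ∧-zeroʳ (x a)))
⋀-linearˡ x M ω (false ∷ S) = ⋀-linearˡ x (λ a k → M a (suc k)) (λ T → ω (false ∷ T)) S
⋀-linearˡ {m} x M ω (true ∷ S) = begin
  ((λ k → ∑ m (λ a → x a ∧ M a (suc k))) ⋀ ω₁) S xor (∑ m (λ a → x a ∧ M a zero) ∧ ω (false ∷ S))
    ≡⟨ cong₂ _xor_ (⋀-linearˡ x (λ a k → M a (suc k)) ω₁ S) (sym (∑-∧ʳ (λ a → x a ∧ M a zero) (ω (false ∷ S)))) ⟩
  ∑ m (λ a → x a ∧ ((λ k → M a (suc k)) ⋀ ω₁) S) xor ∑ m (λ a → (x a ∧ M a zero) ∧ ω (false ∷ S))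
    ≡⟨ ∑-xor _ (λ a → (x a ∧ M a zero) ∧ ω (false ∷ S)) ⟨
  ∑ m (λ a → (x a ∧ ((λ k → M a (suc k)) ⋀ ω₁) S) xor ((x a ∧ M a zero) ∧ ω (false ∷ S)))
    ≡⟨ ∑-cong (λ a → solve 4 (λ p q y o → p :* q :+ (p :* y) :* o := p :* (q :+ y :* o)) refl
                       (x a) _ (M a zero) (ω (false ∷ S))) ⟩
  ∑ m (λ a → x a ∧ (M a ⋀ ω) (true ∷ S)) ∎
  where
  open ≡-Reasoning
  ω₁ : Exterior _
  ω₁ T = ω (true ∷ T)

⋀-comm : ∀ {n} (v w : Fin n → GF2) (ω : Exterior n) S → (v ⋀ w ⋀ ω) S ≡ (w ⋀ v ⋀ ω) S
⋀-comm v w ω []          = refl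
⋀-comm v w ω (false ∷ S) = ⋀-comm _ _ (λ T → ω (false ∷ T)) S
⋀-comm v w ω (true  ∷ S) = begin
  (v′ ⋀ (λ T → (w′ ⋀ ω₁) T xor (w zero ∧ ω₀ T))) S xor (v zero ∧ (w′ ⋀ ω₀) S)
    ≡⟨ cong (_xor (v zero ∧ (w′ ⋀ ω₀) S)) (trans (⋀-linearʳ v′ (w′ ⋀ ω₁) ω₀ (w zero) S)
                                                 (cong (_xor (w zero ∧ (v′ ⋀ ω₀) S)) (⋀-comm v′ w′ ω₁ S))) ⟩
  ((w′ ⋀ v′ ⋀ ω₁) S xor (w zero ∧ (v′ ⋀ ω₀) S)) xor (v zero ∧ (w′ ⋀ ω₀) S)
    ≡⟨ solve 3 (λ a b c → (a :+ b) :+ c := (a :+ c) :+ b) refl ((w′ ⋀ v′ ⋀ ω₁) S) _ _ ⟩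
  ((w′ ⋀ v′ ⋀ ω₁) S xor (v zero ∧ (w′ ⋀ ω₀) S)) xor (w zero ∧ (v′ ⋀ ω₀) S)
    ≡⟨ cong (_xor (w zero ∧ (v′ ⋀ ω₀) S)) (⋀-linearʳ w′ (v′ ⋀ ω₁) ω₀ (v zero) S) ⟨
  (w′ ⋀ (λ T → (v′ ⋀ ω₁) T xor (v zero ∧ ω₀ T))) S xor (w zero ∧ (v′ ⋀ ω₀) S) ∎
  where
  open ≡-Reasoning
  v′ w′ : Fin _ → GF2
  v′ k = v (suc k)
  w′ k = w (suc k)
  ω₀ ω₁ : Exterior _
  ω₀ T = ω (false ∷ T)
  ω₁ T = ω (true ∷ T)

-- The first generator can come from either copy of v; the two contributions are equal and cancel.
⋀-square : ∀ {n} (v : Fin n → GF2) (ω : Exterior n) S → (v ⋀ v ⋀ ω) S ≡ false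
⋀-square v ω []          = refl
⋀-square v ω (false ∷ S) = ⋀-square _ (λ T → ω (false ∷ T)) S
⋀-square v ω (true  ∷ S) = begin
  (v′ ⋀ (λ T → (v′ ⋀ ω₁) T xor (v zero ∧ ω₀ T))) S xor (v zero ∧ (v′ ⋀ ω₀) S)
    ≡⟨ cong (_xor (v zero ∧ (v′ ⋀ ω₀) S)) (trans (⋀-linearʳ v′ (v′ ⋀ ω₁) ω₀ (v zero) S)
                                                 (cong (_xor (v zero ∧ (v′ ⋀ ω₀) S)) (⋀-square v′ ω₁ S))) ⟩
  (v zero ∧ (v′ ⋀ ω₀) S) xor (v zero ∧ (v′ ⋀ ω₀) S)
    ≡⟨ xor-same (v zero ∧ (v′ ⋀ ω₀) S) ⟩
  false ∎
  where
  open ≡-Reasoning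
  v′ : Fin _ → GF2
  v′ k = v (suc k)
  ω₀ ω₁ : Exterior _
  ω₀ T = ω (false ∷ T)
  ω₁ T = ω (true ∷ T)

-- The coefficient at a set of m columns is the minor of M on these columns; the other coefficients
-- vanish.
⋀-rows : ∀ {m n} → Matrix m n → Exterior n
⋀-rows {zero}  M = 𝟙
⋀-rows {suc m} M = M zero ⋀ ⋀-rows (λ a → M (suc a))

⋀-rows-cong : ∀ {m n} {M M′ : Matrix m n} → (∀ a b → M a b ≡ M′ a b) → ∀ S → ⋀-rows M S ≡ ⋀-rows M′ S
⋀-rows-cong {zero}  M≗M′ S = refl
⋀-rows-cong {suc m} M≗M′ S = ⋀-cong (M≗M′ zero) (⋀-rows-cong (λ a → M≗M′ (suc a))) S

-- The extra factor commutes past the other rows until it meets its own copy, where the square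
-- vanishes.
row-⋀-rows : ∀ {m n} (M : Matrix m n) a S → (M a ⋀ ⋀-rows M) S ≡ false
row-⋀-rows M zero    S = ⋀-square (M zero) _ S
row-⋀-rows M (suc a) S = trans (⋀-comm (M (suc a)) (M zero) _ S)
                               (⋀-zeroʳ (M zero) (row-⋀-rows (λ a → M (suc a)) a) S)

-- At the first nonzero coefficient of the relation, the row is a sum of later rows, each of which
-- annihilates the product of the later rows. Multiplying by the earlier rows keeps the product
-- zero.
dependent⇒⋀-rows≡0 : ∀ {m n} (M : Matrix m n) (x : Fin m → GF2) a → x a ≡ true →
                     (∀ k → ∑ m (λ a → x a ∧ M a k) ≡ false) → ∀ S → ⋀-rows M S ≡ false
dependent⇒⋀-rows≡0 {suc m} M x a xa xM≡0 S with x zero in x₀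
dependent⇒⋀-rows≡0 {suc m} M x zero    xa xM≡0 S | false = case trans (sym x₀) xa of λ ()
dependent⇒⋀-rows≡0 {suc m} M x (suc a) xa xM≡0 S | false =
  ⋀-zeroʳ (M zero) (dependent⇒⋀-rows≡0 (λ a → M (suc a)) (λ a → x (suc a)) a xa xM≡0) S
dependent⇒⋀-rows≡0 {suc m} M x a xa xM≡0 S | true = begin
  (M zero ⋀ ω) S
    ≡⟨ ⋀-cong (λ k → xor≡0⇒≡ _ _ (xM≡0 k)) (λ _ → refl) S ⟩
  ((λ k → ∑ m (λ a → x (suc a) ∧ M (suc a) k)) ⋀ ω) S
    ≡⟨ ⋀-linearˡ (λ a → x (suc a)) (λ a → M (suc a)) ω S ⟩
  ∑ m (λ a → x (suc a) ∧ (M (suc a) ⋀ ω) S)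
    ≡⟨ ∑-zero (λ a → trans (cong (x (suc a) ∧_) (row-⋀-rows (λ a → M (suc a)) a S)) (∧-zeroʳ (x (suc a)))) ⟩
  false ∎
  where
  open ≡-Reasoning
  ω : Exterior _
  ω = ⋀-rows (λ a → M (suc a))

  xor≡0⇒≡ : ∀ p q → p xor q ≡ false → p ≡ q
  xor≡0⇒≡ false q eq = sym eq
  xor≡0⇒≡ true true eq = refl

⋀-rows≢0⇒independent : ∀ {m n} (M : Matrix m n) S → ⋀-rows M S ≡ true → RowsIndependent M
⋀-rows≢0⇒independent M S MS≡1 x xM≡0 a = ¬-not
  (λ xa → case trans (sym MS≡1) (dependent⇒⋀-rows≡0 M x a xa xM≡0 S) of λ ())

deg-⋀ : ∀ p d {n} {v : Vec Bool p → Fin n → GF2} {ω : Vec Bool p → Exterior n} →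
        (∀ k → DegreeBelow p 2 (λ x → v x k)) → (∀ S → DegreeBelow p (suc d) (λ x → ω x S)) →
        ∀ S → DegreeBelow p (suc (suc d)) (λ x → (v x ⋀ ω x) S)
deg-⋀ p d vs ωs []          = deg-zero p (suc (suc d))
deg-⋀ p d vs ωs (false ∷ S) = deg-⋀ p d (λ k → vs (suc k)) (λ T → ωs (false ∷ T)) S
deg-⋀ p d vs ωs (true  ∷ S) = deg-xor p (suc (suc d))
  (deg-⋀ p d (λ k → vs (suc k)) (λ T → ωs (true ∷ T)) S)
  (deg-∧ p 1 d (vs zero) (ωs (false ∷ S)))

-- A minor of m rows whose entries have degree at most 1 has degree at most m, since each row
-- contributes one factor.
deg-⋀-rows : ∀ p {m n} {M : Vec Bool p → Matrix m n} → (∀ a b → DegreeBelow p 2 (λ x → M x a b)) →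
             ∀ S → DegreeBelow p (suc m) (λ x → ⋀-rows (M x) S)
deg-⋀-rows p {zero}  Ms S = deg-const p 0 (𝟙 S)
deg-⋀-rows p {suc m} Ms S = deg-⋀ p m (Ms zero) (deg-⋀-rows p (λ a → Ms (suc a))) S

-- Banded Toeplitz matrices

⋀-rows-skip : ∀ {m n} (M : Matrix m (suc n)) S → ⋀-rows M (false ∷ S) ≡ ⋀-rows (λ a b → M a (suc b)) S
⋀-rows-skip {zero}  M S = refl
⋀-rows-skip {suc m} M S = ⋀-cong (λ _ → refl) (⋀-rows-skip (λ a → M (suc a))) S

⋀-rows-column≡0 : ∀ {m n} (M : Matrix m (suc n)) → (∀ a → M a zero ≡ false) → ∀ S → ⋀-rows M (true ∷ S) ≡ false
⋀-rows-column≡0 {zero}  M col≡0 S = refl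
⋀-rows-column≡0 {suc m} M col≡0 S = cong₂ _xor_
  (⋀-zeroʳ _ (⋀-rows-column≡0 (λ a → M (suc a)) (λ a → col≡0 (suc a))) S)
  (cong (_∧ ⋀-rows (λ a → M (suc a)) (false ∷ S)) (col≡0 zero))

⋀-rows-pivot : ∀ {m n} (M : Matrix (suc m) (suc n)) → M zero zero ≡ true → (∀ a → M (suc a) zero ≡ false) →
               ∀ S → ⋀-rows M (true ∷ S) ≡ ⋀-rows (λ a b → M (suc a) (suc b)) S
⋀-rows-pivot M M₀₀ col≡0 S = cong₂ _xor_
  (⋀-zeroʳ _ (⋀-rows-column≡0 (λ a → M (suc a)) col≡0) S)
  (trans (cong (_∧ ⋀-rows (λ a → M (suc a)) (false ∷ S)) M₀₀) (⋀-rows-skip (λ a → M (suc a)) S))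

entry : ∀ {k} → Vec Bool k → ℕ → GF2
entry []      b       = false
entry (x ∷ c) zero    = x
entry (x ∷ c) (suc b) = entry c b

-- toeplitz c a b = c_{b − a}
toeplitz : ∀ {k} → Vec Bool k → ℕ → ℕ → GF2
toeplitz c zero    b       = entry c b
toeplitz c (suc a) zero    = false
toeplitz c (suc a) (suc b) = toeplitz c a b

zero? : ∀ {k} → Vec Bool k → Bool
zero? []      = true
zero? (x ∷ c) = not x ∧ zero? c

toeplitz-false∷ : ∀ {k} (c : Vec Bool k) a b → toeplitz (false ∷ c) a (suc b) ≡ toeplitz c a b
toeplitz-false∷ c zero          b       = refl
toeplitz-false∷ c (suc zero)    zero    = refl
toeplitz-false∷ c (suc (suc a)) zero    = refl
toeplitz-false∷ c (suc a)       (suc b) = toeplitz-false∷ c a b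

toeplitzRows : ∀ {k} → Vec Bool k → ∀ m n → Matrix m n
toeplitzRows c m n a b = toeplitz c (toℕ a) (toℕ b)

-- Each leading zero of c is dropped together with an empty first column; the hypothesis m + k ≤ n
-- leaves enough columns for this. Once c starts with 1, the first m remaining columns form a
-- triangular matrix with unit diagonal, which is expanded pivot by pivot.
toeplitz-⋀-rows : ∀ {k} (c : Vec Bool k) → zero? c ≡ false → ∀ m n → m + k ≤ n →
                  ∃[ S ] (⋀-rows (toeplitzRows c m n) S ≡ true)
toeplitz-⋀-rows {suc k} (false ∷ c) c≢0 m n m+k≤n with subst (_≤ n) (+-suc m k) m+k≤n
toeplitz-⋀-rows {suc k} (false ∷ c) c≢0 m (suc n) _ | s≤s le with toeplitz-⋀-rows c c≢0 m n le
... | S , eq = false ∷ S , trans (⋀-rows-skip (toeplitzRows (false ∷ c) m (suc n)) S)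
                             (trans (⋀-rows-cong {m} (λ a b → toeplitz-false∷ c (toℕ a) (toℕ b)) S) eq)
toeplitz-⋀-rows (true ∷ c) c≢0 zero    n       _        = replicate n false , 𝟙-∅ n
  where
  𝟙-∅ : ∀ n → 𝟙 (replicate n false) ≡ true
  𝟙-∅ zero    = refl
  𝟙-∅ (suc n) = 𝟙-∅ n
toeplitz-⋀-rows (true ∷ c) c≢0 (suc m) (suc n) (s≤s le) with toeplitz-⋀-rows (true ∷ c) c≢0 m n le
... | S , eq = true ∷ S , trans (⋀-rows-pivot (toeplitzRows (true ∷ c) (suc m) (suc n)) refl (λ _ → refl) S) eq

unit : ∀ {k} → Fin k → Vec Bool k
unit {suc k} zero    = true ∷ replicate k false
unit         (suc j) = false ∷ unit j

entry-zero : ∀ k b → entry (replicate k false) b ≡ false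
entry-zero zero    b       = refl
entry-zero (suc k) zero    = refl
entry-zero (suc k) (suc b) = entry-zero k b

entry-units : ∀ {k} (c : Vec Bool k) b → ∑ k (λ j → lookup c j ∧ entry (unit j) b) ≡ entry c b
entry-units []      b = refl
entry-units (x ∷ c) zero = trans
  (cong₂ _xor_ (∧-identityʳ x) (∑-zero (λ j → ∧-zeroʳ (lookup c j)))) (xor-identityʳ x)
entry-units {suc k} (x ∷ c) (suc b) = cong₂ _xor_
  (trans (cong (x ∧_) (entry-zero k b)) (∧-zeroʳ x)) (entry-units c b)

-- Since `toeplitz (unit j)` is the j-th power of the nilpotent shift, this identifies `toeplitz c`
-- as a combination of the first k powers.
toeplitz-units : ∀ {k} (c : Vec Bool k) a b → ∑ k (λ j → lookup c j ∧ toeplitz (unit j) a b) ≡ toeplitz c a b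
toeplitz-units c zero    b       = entry-units c b
toeplitz-units c (suc a) zero    = ∑-zero (λ j → ∧-zeroʳ (lookup c j))
toeplitz-units c (suc a) (suc b) = toeplitz-units c a b

-- Counting

bit : Bool → ℕ
bit false = 0
bit true  = 1

count : ∀ {r} → (Fin r → Bool) → ℕ
count f = sum (λ t → bit (f t))

sum-mono : ∀ {r} {f g : Fin r → ℕ} → (∀ t → f t ≤ g t) → sum f ≤ sum g
sum-mono {zero}  f≤g = z≤n
sum-mono {suc r} f≤g = +-mono-≤ (f≤g zero) (sum-mono (λ t → f≤g (suc t)))

-- Once the term at `τ zero` is taken out of the large sum, `punchOut` makes the rest of τ an
-- injection into the remaining positions.
sum-injective : ∀ {s r} (τ : Fin s → Fin r) → (∀ {i j} → τ i ≡ τ j → i ≡ j) →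
                (f : Fin r → ℕ) → sum (λ i → f (τ i)) ≤ sum f
sum-injective {zero}          τ inj f = z≤n
sum-injective {suc s} {zero}  τ inj f = case τ zero of λ ()
sum-injective {suc s} {suc r} τ inj f = begin
  f (τ zero) + sum (λ i → f (τ (suc i)))
    ≡⟨ cong (f (τ zero) +_) (sum-cong-≗ (λ i → cong f (punchIn-punchOut (τ₀≢ i)))) ⟨
  f (τ zero) + sum (λ i → f (punchIn (τ zero) (punchOut (τ₀≢ i))))
    ≤⟨ +-monoʳ-≤ (f (τ zero)) (sum-injective (λ i → punchOut (τ₀≢ i))
         (λ {i} {j} eq → suc-injective (inj (punchOut-injective (τ₀≢ i) (τ₀≢ j) eq)))
         (λ t → f (punchIn (τ zero) t))) ⟩
  f (τ zero) + sum (λ t → f (punchIn (τ zero) t))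
    ≡⟨ sum-remove f ⟨
  sum f ∎
  where
  open ≤-Reasoning
  τ₀≢ : ∀ i → τ zero ≢ τ (suc i)
  τ₀≢ i eq = case inj eq of λ ()

sum-split : ∀ p q (f : Fin (p + q) → ℕ) → sum f ≡ sum (λ i → f (i ↑ˡ q)) + sum (λ j → f (p ↑ʳ j))
sum-split zero    q f = refl
sum-split (suc p) q f = trans (cong (f zero +_) (sum-split p q (λ i → f (suc i)))) (sym (+-assoc (f zero) _ _))

sum-combine : ∀ p q (f : Fin (p * q) → ℕ) → sum f ≡ sum (λ i → sum (λ j → f (combine {p} i j)))
sum-combine zero    q f = refl
sum-combine (suc p) q f = trans (sum-split q (p * q) f)
  (cong (sum (λ j → f (j ↑ˡ (p * q))) +_) (sum-combine p q (λ l → f (q ↑ʳ l))))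

sum-const-1 : ∀ r → sum {r} (λ _ → 1) ≡ r
sum-const-1 zero    = refl
sum-const-1 (suc r) = cong suc (sum-const-1 r)

sum-* : ∀ {r} a (f : Fin r → ℕ) → sum (λ t → a * f t) ≡ a * sum f
sum-* {zero}  a f = sym (*-zeroʳ a)
sum-* {suc r} a f = trans (cong (a * f zero +_) (sum-* a (λ t → f (suc t)))) (sym (*-distribˡ-+ a (f zero) _))

count-complement : ∀ {r} (f : Fin r → Bool) → count f + count (λ t → not (f t)) ≡ r
count-complement {r} f = trans (sym (∑-distrib-+ (λ t → bit (f t)) (λ t → bit (not (f t)))))
  (trans (sum-cong-≗ (λ t → bit-complement (f t))) (sum-const-1 r))
  where
  bit-complement : ∀ b → bit b + bit (not b) ≡ 1
  bit-complement false = refl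
  bit-complement true  = refl

weight≡count : ∀ {m} (v : Vec Bool m) → weight v ≡ count (lookup v)
weight≡count []          = refl
weight≡count (false ∷ v) = weight≡count v
weight≡count (true  ∷ v) = cong suc (weight≡count v)

nonzero? : ∀ {k} → (Fin k → Bool) → Bool
nonzero? {zero}  y = false
nonzero? {suc k} y = y zero ∨ nonzero? (λ j → y (suc j))

nonzero?≤count : ∀ {k} (y : Fin k → Bool) → bit (nonzero? y) ≤ count y
nonzero?≤count {zero}  y = z≤n
nonzero?≤count {suc k} y with y zero
... | true  = s≤s z≤n
... | false = nonzero?≤count (λ j → y (suc j))

-- Of the N positions chosen by τ, at most `weight x` meet the support of the rows of y, because
-- each of these uses up a 1 in x. The others lie among the positions outside the support.
support-bound : ∀ {k N r} (y : Matrix k r) (τ : Fin N → Fin r) → (∀ {i j} → τ i ≡ τ j → i ≡ j) →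
                (x : Vec Bool (k * N)) → (∀ j i → y j (τ i) ≡ lookup x (combine j i)) →
                count (λ t → nonzero? (λ j → y j t)) + N ≤ r + weight x
support-bound {k} {N} {r} y τ τ-inj x yτ≡x = begin
  count u + N
    ≡⟨ cong (count u +_) (count-complement (λ i → u (τ i))) ⟨
  count u + (count (λ i → u (τ i)) + count (λ i → not (u (τ i))))
    ≤⟨ +-monoʳ-≤ (count u) (+-mono-≤ light (sum-injective τ τ-inj (λ t → bit (not (u t))))) ⟩
  count u + (weight x + count (λ t → not (u t)))
    ≡⟨ cong (count u +_) (+-comm (weight x) _) ⟩
  count u + (count (λ t → not (u t)) + weight x)
    ≡⟨ +-assoc (count u) _ (weight x) ⟨
  count u + count (λ t → not (u t)) + weight x
    ≡⟨ cong (_+ weight x) (count-complement u) ⟩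
  r + weight x ∎
  where
  open ≤-Reasoning
  u : Fin r → Bool
  u t = nonzero? (λ j → y j t)

  light : count (λ i → u (τ i)) ≤ weight x
  light = begin
    count (λ i → u (τ i))
      ≤⟨ sum-mono (λ i → nonzero?≤count (λ j → y j (τ i))) ⟩
    sum (λ i → sum (λ j → bit (y j (τ i))))
      ≡⟨ ∑-comm (λ i j → bit (y j (τ i))) ⟩
    sum (λ j → sum (λ i → bit (y j (τ i))))
      ≡⟨ sum-cong-≗ (λ j → sum-cong-≗ (λ i → cong bit (yτ≡x j i))) ⟩
    sum (λ j → sum (λ i → bit (lookup x (combine {k} {N} j i))))
      ≡⟨ sum-combine k N (λ l → bit (lookup x l)) ⟨
    count (lookup x)
      ≡⟨ weight≡count x ⟨
    weight x ∎

-- Sums over all coefficient vectors and the Plotkin bound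

sumOver : ∀ k → (Vec Bool k → ℕ) → ℕ
sumOver zero    f = f []
sumOver (suc k) f = sumOver k (λ c → f (false ∷ c)) + sumOver k (λ c → f (true ∷ c))

sumOver-sum : ∀ k {r} (f : Vec Bool k → Fin r → ℕ) →
              sumOver k (λ c → sum (f c)) ≡ sum (λ t → sumOver k (λ c → f c t))
sumOver-sum zero    f = refl
sumOver-sum (suc k) f = trans
  (cong₂ _+_ (sumOver-sum k (λ c → f (false ∷ c))) (sumOver-sum k (λ c → f (true ∷ c))))
  (sym (∑-distrib-+ (λ t → sumOver k (λ c → f (false ∷ c) t)) (λ t → sumOver k (λ c → f (true ∷ c) t))))

2^suc : ∀ k a → 2 ^ suc k * a ≡ 2 ^ k * a + 2 ^ k * a
2^suc k a = solveℕ 2 (λ q a → (conℕ 2 ⊗ q) ⊗ a ⊜ q ⊗ a ⊕ q ⊗ a) refl (2 ^ k) a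

sumOver-lower : ∀ k {A} {f : Vec Bool k → ℕ} → (∀ c → A ≤ f c) → 2 ^ k * A ≤ sumOver k f
sumOver-lower zero    {A} A≤f = ≤-trans (≤-reflexive (*-identityˡ A)) (A≤f [])
sumOver-lower (suc k) {A} A≤f = ≤-trans (≤-reflexive (2^suc k A))
  (+-mono-≤ (sumOver-lower k (λ c → A≤f (false ∷ c))) (sumOver-lower k (λ c → A≤f (true ∷ c))))

-- Only the zero vector may miss the bound; the summand A on the right makes up for it without
-- subtraction.
sumOver-lower-nonzero : ∀ k {A} {f : Vec Bool k → ℕ} → (∀ c → zero? c ≡ false → A ≤ f c) →
                        2 ^ k * A ≤ sumOver k f + A
sumOver-lower-nonzero zero {A} {f} A≤f = ≤-trans (≤-reflexive (*-identityˡ A)) (m≤n+m A (f []))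
sumOver-lower-nonzero (suc k) {A} {f} A≤f = begin
  2 ^ suc k * A            ≡⟨ 2^suc k A ⟩
  2 ^ k * A + 2 ^ k * A    ≤⟨ +-mono-≤ (sumOver-lower-nonzero k (λ c c≢0 → A≤f (false ∷ c) c≢0))
                                       (sumOver-lower k (λ c → A≤f (true ∷ c) refl)) ⟩
  (s₀ + A) + s₁            ≡⟨ solveℕ 3 (λ a b c → (a ⊕ b) ⊕ c ⊜ (a ⊕ c) ⊕ b) refl s₀ A s₁ ⟩
  (s₀ + s₁) + A            ∎
  where
  open ≤-Reasoning
  s₀ s₁ : ℕ
  s₀ = sumOver k (λ c → f (false ∷ c))
  s₁ = sumOver k (λ c → f (true ∷ c))

sumOver-complement : ∀ k (f : Vec Bool k → Bool) →
                     sumOver k (λ c → bit (f c)) + sumOver k (λ c → bit (not (f c))) ≡ 2 ^ k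
sumOver-complement zero f with f []
... | false = refl
... | true  = refl
sumOver-complement (suc k) f = trans
  (solveℕ 4 (λ a b c d → (a ⊕ b) ⊕ (c ⊕ d) ⊜ (a ⊕ c) ⊕ ((b ⊕ d) ⊕ conℕ 0)) refl
    (sumOver k (λ c → bit (f (false ∷ c)))) (sumOver k (λ c → bit (f (true ∷ c))))
    (sumOver k (λ c → bit (not (f (false ∷ c))))) (sumOver k (λ c → bit (not (f (true ∷ c))))))
  (cong₂ (λ a b → a + (b + 0)) (sumOver-complement k (λ c → f (false ∷ c)))
                               (sumOver-complement k (λ c → f (true ∷ c))))

dot : ∀ {k} → Vec Bool k → (Fin k → Bool) → Bool
dot {k} c y = ∑ k (λ j → lookup c j ∧ y j)

-- A nonzero linear functional is 1 on exactly half of all vectors: where y has a 1, flipping that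
-- coordinate of c flips the value.
sumOver-dot : ∀ {k} (y : Fin k → Bool) → 2 * sumOver k (λ c → bit (dot c y)) ≤ 2 ^ k * bit (nonzero? y)
sumOver-dot {zero}  y = z≤n
sumOver-dot {suc k} y with y zero
... | false = begin
  2 * (h + h)                               ≡⟨ *-distribˡ-+ 2 h h ⟩
  2 * h + 2 * h                             ≤⟨ +-mono-≤ (sumOver-dot (λ j → y (suc j))) (sumOver-dot (λ j → y (suc j))) ⟩
  2 ^ k * b + 2 ^ k * b                     ≡⟨ 2^suc k b ⟨
  2 ^ suc k * b                             ∎
  where
  open ≤-Reasoning
  h b : ℕ
  h = sumOver k (λ c → bit (dot c (λ j → y (suc j))))
  b = bit (nonzero? (λ j → y (suc j)))
... | true = begin
  2 * (sumOver k (λ c → bit (dot c (λ j → y (suc j)))) + sumOver k (λ c → bit (not (dot c (λ j → y (suc j))))))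
    ≡⟨ cong (2 *_) (sumOver-complement k (λ c → dot c (λ j → y (suc j)))) ⟩
  2 ^ suc k
    ≡⟨ *-identityʳ (2 ^ suc k) ⟨
  2 ^ suc k * 1 ∎
  where open ≤-Reasoning

-- Double counting of the ones in all 2ᵏ codewords: each nonzero c contributes at least A, and each
-- position of the support is 1 in half of the codewords.
plotkin : ∀ {k r} (y : Matrix k r) A →
          (∀ c → zero? c ≡ false → A ≤ count (λ t → dot c (λ j → y j t))) →
          2 * (2 ^ k * A) ≤ 2 ^ k * count (λ t → nonzero? (λ j → y j t)) + 2 * A
plotkin {k} {r} y A A≤ = begin
  2 * (2 ^ k * A)
    ≤⟨ *-monoʳ-≤ 2 (sumOver-lower-nonzero k A≤) ⟩
  2 * (sumOver k (λ c → count (λ t → dot c (λ j → y j t))) + A)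
    ≡⟨ *-distribˡ-+ 2 (sumOver k (λ c → count (λ t → dot c (λ j → y j t)))) A ⟩
  2 * sumOver k (λ c → count (λ t → dot c (λ j → y j t))) + 2 * A
    ≤⟨ +-monoˡ-≤ (2 * A) (begin
        2 * sumOver k (λ c → count (λ t → dot c (λ j → y j t)))
          ≡⟨ cong (2 *_) (sumOver-sum k (λ c t → bit (dot c (λ j → y j t)))) ⟩
        2 * sum (λ t → sumOver k (λ c → bit (dot c (λ j → y j t))))
          ≡⟨ sum-* 2 (λ t → sumOver k (λ c → bit (dot c (λ j → y j t)))) ⟨
        sum (λ t → 2 * sumOver k (λ c → bit (dot c (λ j → y j t))))
          ≤⟨ sum-mono (λ t → sumOver-dot (λ j → y j t)) ⟩
        sum (λ t → 2 ^ k * bit (nonzero? (λ j → y j t)))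
          ≡⟨ sum-* (2 ^ k) (λ t → bit (nonzero? (λ j → y j t))) ⟩
        2 ^ k * count (λ t → nonzero? (λ j → y j t)) ∎) ⟩
  2 ^ k * count (λ t → nonzero? (λ j → y j t)) + 2 * A ∎
  where open ≤-Reasoning

-- Products of tests, and the rank of a masked matrix

allOf : ∀ k → (Vec Bool k → Bool) → Bool
allOf zero    f = f []
allOf (suc k) f = allOf k (λ c → f (false ∷ c)) ∧ allOf k (λ c → f (true ∷ c))

allOf-intro : ∀ k {f} → (∀ c → f c ≡ true) → allOf k f ≡ true
allOf-intro zero    fs = fs []
allOf-intro (suc k) fs = cong₂ _∧_ (allOf-intro k (λ c → fs (false ∷ c))) (allOf-intro k (λ c → fs (true ∷ c)))

allOf-elim : ∀ {k} f → allOf k f ≡ true → ∀ c → f c ≡ true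
allOf-elim f eq [] = eq
allOf-elim {suc k} f eq (b ∷ c) with allOf k (λ c → f (false ∷ c)) in eq₀ | allOf k (λ c → f (true ∷ c)) in eq₁
allOf-elim f eq (false ∷ c) | true | true = allOf-elim _ eq₀ c
allOf-elim f eq (true  ∷ c) | true | true = allOf-elim _ eq₁ c

-- Conjunction is multiplication in GF(2), so the degrees of the 2ᵏ factors add up.
deg-allOf : ∀ p k d {F : Vec Bool k → Vec Bool p → Bool} → (∀ c → DegreeBelow p (suc d) (F c)) →
            DegreeBelow p (suc (2 ^ k * d)) (λ x → allOf k (λ c → F c x))
deg-allOf p zero    d {F} Fs = subst (λ e → DegreeBelow p (suc e) (F [])) (sym (*-identityˡ d)) (Fs [])
deg-allOf p (suc k) d {F} Fs = subst (λ e → DegreeBelow p (suc e) (λ x → allOf (suc k) (λ c → F c x))) (sym (2^suc k d))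
  (deg-∧ p (2 ^ k * d) (2 ^ k * d) (deg-allOf p k d (λ c → Fs (false ∷ c))) (deg-allOf p k d (λ c → Fs (true ∷ c))))

-- An invertible minor has s distinct columns, and none of them can be masked out: a zero column
-- would give a zero on the diagonal of the product with the inverse.
masked-rank : ∀ {s r} (g : Fin r → GF2) (B : Matrix s r) → RowsIndependent (λ l t → g t ∧ B l t) → s ≤ count g
masked-rank {s} {r} g B indep = bound (invertibleMinor _ indep)
  where
  bound : InvertibleMinor (λ l t → g t ∧ B l t) → s ≤ count g
  bound minor = ≤-trans
    (≤-reflexive (trans (sym (sum-const-1 s)) (sum-cong-≗ (λ i → cong bit (sym (used i))))))
    (sum-injective column column-injective (λ t → bit (g t)))
    where
    open InvertibleMinor minor

    used : ∀ i → g (column i) ≡ true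
    used i = ¬-not (λ unused → case trans (sym (δ-refl i)) (trans (sym (left i i))
      (∑-zero (λ l → trans (cong (λ b → inverse i l ∧ (b ∧ B l (column i))) unused) (∧-zeroʳ (inverse i l))))) of λ ())

-- The code of a bilinear algorithm

module _ {n r} (μ η : Fin r → LinearForm n) (spans : SpansMatMul n r μ η) where

  generator : Matrix (n * n) r
  generator l t = proj₁ (spans (proj₁ (remQuot {n} n l)) (proj₂ (remQuot {n} n l))) t

  -- This is the map Γ, with Z flattened so that z_ij sits at `combine i j`.
  code : (Fin (n * n) → GF2) → Fin r → GF2
  code Z t = ∑ (n * n) (λ l → Z l ∧ generator l t)

  -- Both sides are the coefficient of x_ab y_cd in Σ z_ij (xy)_ij, computed on the left through the
  -- products and on the right from the definition.
  code-tensor : ∀ Z a b c d →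
                ∑ r (λ t → code Z t ∧ prod (μ t) (η t) a b c d) ≡ δ b c ∧ Z (combine a d)
  code-tensor Z a b c d = begin
    ∑ r (λ t → code Z t ∧ prod (μ t) (η t) a b c d)
      ≡⟨ ∑-assoc Z generator (λ t → prod (μ t) (η t) a b c d) ⟩
    ∑ (n * n) (λ l → Z l ∧ ∑ r (λ t → generator l t ∧ prod (μ t) (η t) a b c d))
      ≡⟨ ∑-cong (λ l → cong (Z l ∧_) (proj₂ (spans (proj₁ (remQuot {n} n l)) (proj₂ (remQuot {n} n l))) a b c d)) ⟩
    ∑ (n * n) (λ l → Z l ∧ matMulEntry (proj₁ (remQuot {n} n l)) (proj₂ (remQuot {n} n l)) a b c d)
      ≡⟨ ∑-combine n n _ ⟩
    ∑ n (λ i → ∑ n (λ j → Z (combine i j) ∧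
      matMulEntry (proj₁ (remQuot {n} n (combine i j))) (proj₂ (remQuot {n} n (combine i j))) a b c d))
      ≡⟨ ∑-cong (λ i → ∑-cong (λ j → trans
           (cong (λ ij → Z (combine i j) ∧ matMulEntry (proj₁ ij) (proj₂ ij) a b c d) (remQuot-combine i j))
           (solve 4 (λ z x y w → z :* (x :* (y :* w)) := x :* (w :* (y :* z))) refl
             (Z (combine i j)) (δ a i) (δ b c) (δ d j)))) ⟩
    ∑ n (λ i → ∑ n (λ j → δ a i ∧ (δ d j ∧ (δ b c ∧ Z (combine i j)))))
      ≡⟨ ∑-cong (λ i → ∑-∧ˡ (δ a i) (λ j → δ d j ∧ (δ b c ∧ Z (combine i j)))) ⟩
    ∑ n (λ i → δ a i ∧ ∑ n (λ j → δ d j ∧ (δ b c ∧ Z (combine i j))))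
      ≡⟨ ∑-δˡ (λ i → ∑ n (λ j → δ d j ∧ (δ b c ∧ Z (combine i j)))) a ⟩
    ∑ n (λ j → δ d j ∧ (δ b c ∧ Z (combine a j)))
      ≡⟨ ∑-δˡ (λ j → δ b c ∧ Z (combine a j)) d ⟩
    δ b c ∧ Z (combine a d) ∎
    where open ≡-Reasoning

  -- Γ is injective, as z_ad can be read off as the coefficient of x_aa y_ad.
  generator-independent : RowsIndependent generator
  generator-independent Z ZG≡0 l = trans (cong Z (sym (combine-remQuot {n} n l))) (Z≡0 (proj₁ (remQuot {n} n l)) (proj₂ (remQuot {n} n l)))
    where
    Z≡0 : ∀ a d → Z (combine a d) ≡ false
    Z≡0 a d = trans (cong (_∧ Z (combine a d)) (sym (δ-refl a)))
      (trans (sym (code-tensor Z a a a d)) (∑-zero (λ t → cong (_∧ prod (μ t) (η t) a a a d) (ZG≡0 t))))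

  rows : ∀ {m} → m ≤ n → (Fin (n * n) → GF2) → Matrix m n
  rows m≤n Z a d = Z (combine (inject≤ a m≤n) d)

  -- If all μ_t with code Z t = 1 vanish at X, then XᵀZ = 0; so these μ_t are
  -- jointly injective on the X supported on the first m rows.
  code-weight : ∀ {m} (m≤n : m ≤ n) Z → RowsIndependent (rows m≤n Z) → m * n ≤ count (code Z)
  code-weight {m} m≤n Z indep = masked-rank (code Z) B A-independent
    where
    open ≡-Reasoning

    B A : Matrix (m * n) r
    B l t = μ t (inject≤ (proj₁ (remQuot {m} n l)) m≤n) (proj₂ (remQuot {m} n l))
    A l t = code Z t ∧ B l t

    A-independent : RowsIndependent A
    A-independent X XA≡0 l = trans (cong X (sym (combine-remQuot {m} n l)))
      -- Column b of X is a relation among the rows of Z, because row b of XᵀZ vanishes.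
      (indep (λ a → X (combine a b)) (λ d → trans (sym (XᵀZ b d)) (∑-zero (λ t → cong (_∧ η t b d) (XA≡0 t))))
        (proj₁ (remQuot {m} n l)))
      where
      b : Fin n
      b = proj₂ (remQuot {m} n l)

      XᵀZ : ∀ c d → ∑ r (λ t → ∑ (m * n) (λ l → X l ∧ A l t) ∧ η t c d)
                    ≡ ∑ m (λ a → X (combine a c) ∧ rows m≤n Z a d)
      XᵀZ c d = begin
        ∑ r (λ t → ∑ (m * n) (λ l → X l ∧ A l t) ∧ η t c d)
          ≡⟨ ∑-assoc X A (λ t → η t c d) ⟩
        ∑ (m * n) (λ l → X l ∧ ∑ r (λ t → A l t ∧ η t c d))
          ≡⟨ ∑-cong (λ l → cong (X l ∧_) (trans
               (∑-cong (λ t → ∧-assoc (code Z t) _ (η t c d)))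
               (code-tensor Z (inject≤ (proj₁ (remQuot {m} n l)) m≤n) (proj₂ (remQuot {m} n l)) c d))) ⟩
        ∑ (m * n) (λ l → X l ∧ (δ (proj₂ (remQuot {m} n l)) c ∧ rows m≤n Z (proj₁ (remQuot {m} n l)) d))
          ≡⟨ ∑-combine m n _ ⟩
        ∑ m (λ a → ∑ n (λ b → X (combine a b) ∧
          (δ (proj₂ (remQuot {m} n (combine a b))) c ∧ rows m≤n Z (proj₁ (remQuot {m} n (combine a b))) d)))
          ≡⟨ ∑-cong (λ a → ∑-cong (λ b → trans
               (cong (λ ab → X (combine a b) ∧ (δ (proj₂ ab) c ∧ rows m≤n Z (proj₁ ab) d)) (remQuot-combine a b))
               (solve 3 (λ x e z → x :* (e :* z) := (x :* z) :* e) refl (X (combine a b)) (δ b c) (rows m≤n Z a d)))) ⟩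
        ∑ m (λ a → ∑ n (λ b → (X (combine a b) ∧ rows m≤n Z a d) ∧ δ b c))
          ≡⟨ ∑-cong (λ a → ∑-δʳ (λ b → X (combine a b) ∧ rows m≤n Z a d) c) ⟩
        ∑ m (λ a → X (combine a c) ∧ rows m≤n Z a d) ∎

  -- A light family whose nonzero combinations have independent rows

  module _ (minor : InvertibleMinor generator) (k m : ℕ) (m+k≤n : m + k ≤ n) where
    open InvertibleMinor minor

    -- A vector x of k n² bits is read as the coordinates of k matrices with
    -- respect to the basis of matrices dual to the n² chosen coordinates.
    basisSum : Vec Bool (k * (n * n)) → Matrix k (n * n)
    basisSum x j l = ∑ (n * n) (λ i → lookup x (combine j i) ∧ inverse i l)

    element : Vec Bool (k * (n * n)) → Vec Bool k → Fin (n * n) → GF2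
    element x c l = ∑ k (λ j → lookup c j ∧ basisSum x j l)

    code-element : ∀ x c t → code (element x c) t ≡ dot c (λ j → code (basisSum x j) t)
    code-element x c t = ∑-assoc (lookup c) (basisSum x) (λ l → generator l t)

    -- By `left`, the i-th basis matrix has code 1 at `column i` and 0 at the other chosen columns.
    code-basisSum : ∀ x j i → code (basisSum x j) (column i) ≡ lookup x (combine j i)
    code-basisSum x j i = trans
      (∑-assoc (λ i → lookup x (combine j i)) inverse (λ l → generator l (column i)))
      (trans (∑-cong (λ i′ → cong (lookup x (combine j i′) ∧_) (left i′ i)))
             (∑-δʳ (λ i → lookup x (combine j i)) i))

    shift : Matrix k (n * n)
    shift j l = toeplitz (unit j) (toℕ (proj₁ (remQuot {n} n l))) (toℕ (proj₂ (remQuot {n} n l)))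

    -- The point x that encodes the first k powers of the nilpotent shift: its bits are their codes
    -- at the chosen columns. It witnesses that the product of tests is not the zero function.
    shifts : Vec Bool (k * (n * n))
    shifts = tabulate (λ ji → coordinate (remQuot (n * n) ji))
      where
      coordinate : Fin k × Fin (n * n) → Bool
      coordinate (j , i) = ∑ (n * n) (λ l → shift j l ∧ generator l (column i))

    basisSum-shifts : ∀ j l → basisSum shifts j l ≡ shift j l
    basisSum-shifts j l = begin
      ∑ (n * n) (λ i → lookup shifts (combine j i) ∧ inverse i l)
        ≡⟨ ∑-cong (λ i → cong (_∧ inverse i l) (lookup-shifts i)) ⟩
      ∑ (n * n) (λ i → ∑ (n * n) (λ l′ → shift j l′ ∧ generator l′ (column i)) ∧ inverse i l)
        ≡⟨ ∑-assoc (shift j) (λ l′ i → generator l′ (column i)) (λ i → inverse i l) ⟩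
      ∑ (n * n) (λ l′ → shift j l′ ∧ ∑ (n * n) (λ i → generator l′ (column i) ∧ inverse i l))
        ≡⟨ ∑-cong (λ l′ → cong (shift j l′ ∧_) (right l′ l)) ⟩
      ∑ (n * n) (λ l′ → shift j l′ ∧ δ l′ l)
        ≡⟨ ∑-δʳ (shift j) l ⟩
      shift j l ∎
      where
      open ≡-Reasoning
      lookup-shifts : ∀ i → lookup shifts (combine j i) ≡ ∑ (n * n) (λ l → shift j l ∧ generator l (column i))
      lookup-shifts i = trans (lookup∘tabulate _ (combine j i))
        (cong (λ ji → ∑ (n * n) (λ l → shift (proj₁ ji) l ∧ generator l (column (proj₂ ji)))) (remQuot-combine j i))

    m≤n : m ≤ n
    m≤n = ≤-trans (m≤m+n m k) m+k≤n

    rows-shifts : ∀ c a d → rows m≤n (element shifts c) a d ≡ toeplitzRows c m n a d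
    rows-shifts c a d = begin
      ∑ k (λ j → lookup c j ∧ basisSum shifts j (combine a′ d))
        ≡⟨ ∑-cong (λ j → cong (lookup c j ∧_) (trans (basisSum-shifts j (combine a′ d))
             (trans (cong (λ ad → toeplitz (unit j) (toℕ (proj₁ ad)) (toℕ (proj₂ ad))) (remQuot-combine a′ d))
                    (cong (λ a → toeplitz (unit j) a (toℕ d)) (toℕ-inject≤ a m≤n))))) ⟩
      ∑ k (λ j → lookup c j ∧ toeplitz (unit j) (toℕ a) (toℕ d))
        ≡⟨ toeplitz-units c (toℕ a) (toℕ d) ⟩
      toeplitz c (toℕ a) (toℕ d) ∎
      where
      open ≡-Reasoning
      a′ : Fin n
      a′ = inject≤ a m≤n

    deg-rows : ∀ c a d → DegreeBelow (k * (n * n)) 2 (λ x → rows m≤n (element x c) a d)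
    deg-rows c a d = deg-∑ p 2 (λ j → deg-∧ p 0 1 (deg-const p 0 (lookup c j))
      (deg-∑ p 2 (λ i → deg-cong p 2 (λ x → ∧-comm (inverse i (combine (inject≤ a m≤n) d)) (lookup x (combine j i)))
        (deg-∧ p 0 1 (deg-const p 0 (inverse i (combine (inject≤ a m≤n) d))) (deg-lookup (combine j i))))))
      where
      p : ℕ
      p = k * (n * n)

    -- One minor per c suffices: it may miss independent rows at some x, provided that it is nonzero
    -- at `shifts`.
    record IndependenceTest (c : Vec Bool k) : Set where
      field
        test     : Vec Bool (k * (n * n)) → Bool
        degree   : DegreeBelow (k * (n * n)) (suc m) test
        complete : test shifts ≡ true
        sound    : zero? c ≡ false → ∀ x → test x ≡ true → RowsIndependent (rows m≤n (element x c))

    independenceTest : ∀ c → IndependenceTest c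
    independenceTest c with zero? c in c≟0
    -- Nothing is required of c = 0; the constant 1 lets the product run over all c.
    ... | true = record
      { test = λ _ → true ; degree = deg-const (k * (n * n)) m true ; complete = refl
      ; sound = λ c≢0 → case trans (sym c≟0) c≢0 of λ () }
    ... | false with toeplitz-⋀-rows c c≟0 m n m+k≤n
    ...   | S , nonzero = record
      { test     = λ x → ⋀-rows (rows m≤n (element x c)) S
      ; degree   = deg-⋀-rows (k * (n * n)) (deg-rows c) S
      ; complete = trans (⋀-rows-cong (rows-shifts c) S) nonzero
      ; sound    = λ _ x → ⋀-rows≢0⇒independent (rows m≤n (element x c)) S }

    -- The product of the 2ᵏ tests has degree at most 2ᵏ m and is 1 at `shifts`, so it is also 1 at
    -- some point of weight at most 2ᵏ m.
    lightFamily : ∃[ x ] (weight x ≤ 2 ^ k * m ×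
                          (∀ c → zero? c ≡ false → RowsIndependent (rows m≤n (element x c))))
    lightFamily with zeroOrLightPoint (k * (n * n)) (suc (2 ^ k * m)) tests
                       (deg-allOf (k * (n * n)) k m (λ c → IndependenceTest.degree (independenceTest c)))
      where
      tests : Vec Bool (k * (n * n)) → Bool
      tests x = allOf k (λ c → IndependenceTest.test (independenceTest c) x)
    ... | inj₁ tests≡0 = case trans (sym (allOf-intro k (λ c → IndependenceTest.complete (independenceTest c)))) (tests≡0 shifts) of λ ()
    ... | inj₂ (x , s≤s light , pass) = x , light , λ c c≢0 →
      IndependenceTest.sound (independenceTest c) c≢0 x (allOf-elim (λ c → IndependenceTest.test (independenceTest c) x) pass c)

    -- Here u is the size of the support of the code spanned by the k codewords. The Plotkin bound
    -- with distance m n bounds it from below, and the n² chosen columns bound it from above.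
    rank-bound : ∃[ u ] (2 * (2 ^ k * (m * n)) ≤ 2 ^ k * u + 2 * (m * n) × u + n * n ≤ r + 2 ^ k * m)
    rank-bound with lightFamily
    ... | x , light , indep =
      count (λ t → nonzero? (λ j → y j t)) ,
      plotkin y (m * n) (λ c c≢0 → ≤-trans (code-weight m≤n (element x c) (indep c c≢0))
        (≤-reflexive (sum-cong-≗ (λ t → cong bit (code-element x c t))))) ,
      ≤-trans (support-bound y column column-injective x (code-basisSum x)) (+-monoʳ-≤ r light)
      where
      y : Matrix k r
      y j = code (basisSum x j)

-- Choice of k and the final estimate

n≤2^n : ∀ n → n ≤ 2 ^ n
n≤2^n zero    = z≤n
n≤2^n (suc n) = begin
  suc n            ≤⟨ +-mono-≤ (m^n>0 2 n) (n≤2^n n) ⟩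
  2 ^ n + 2 ^ n    ≡⟨ cong (2 ^ n +_) (+-identityʳ (2 ^ n)) ⟨
  2 ^ suc n        ∎
  where open ≤-Reasoning

-- This makes 2ᵏ equal to n^{1/3} up to a factor 2. In the step from n to n + 1, k grows only once n
-- has reached (2ᵏ⁺¹)³.
scale : ∀ n → 1 ≤ n → ∃[ k ] ((2 ^ k) ^ 3 ≤ n × n ≤ (2 ^ suc k) ^ 3)
scale (suc zero)    _ = 0 , s≤s z≤n , s≤s z≤n
scale (suc (suc n)) _ with scale (suc n) (s≤s z≤n)
... | k , lower , upper with suc n <? (2 ^ suc k) ^ 3
...   | yes n<  = k , m≤n⇒m≤1+n lower , n<
...   | no  n≮  = suc k , m≤n⇒m≤1+n (≮⇒≥ n≮) ,
  ≤-<-trans upper (^-monoˡ-< 3 (^-monoʳ-< 2 (s≤s (s≤s z≤n)) (n<1+n (suc k))))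

-- Here q = 2ᵏ, and each of the error terms q²m, 2mn and 2qkn is O(n²) as q² ≤ n.
scaled-deficit : ∀ q k m n r u → k ≤ q → q * q ≤ n → m + k ≡ n →
                 2 * (q * (m * n)) ≤ q * u + 2 * (m * n) → u + n * n ≤ r + q * m →
                 q * (3 * n ^ 2) ≤ q * r + 5 * (n * n)
scaled-deficit q k m n r u k≤q qq≤n m+k≡n plotkin≤ support≤ = +-cancelˡ-≤ (q * u) _ _ (begin
  q * u + q * (3 * n ^ 2)
    ≡⟨ solveℕ 3 (λ q u n → q ⊗ u ⊕ q ⊗ (conℕ 3 ⊗ (n ⊗ (n ⊗ conℕ 1)))
         ⊜ q ⊗ (u ⊕ n ⊗ n) ⊕ conℕ 2 ⊗ (q ⊗ (n ⊗ n))) refl q u n ⟩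
  q * (u + n * n) + 2 * (q * (n * n))
    ≡⟨ cong (λ h → q * (u + n * n) + 2 * (q * (h * n))) m+k≡n ⟨
  q * (u + n * n) + 2 * (q * ((m + k) * n))
    ≡⟨ solveℕ 5 (λ q a m k n → q ⊗ a ⊕ conℕ 2 ⊗ (q ⊗ ((m ⊕ k) ⊗ n))
         ⊜ q ⊗ a ⊕ (conℕ 2 ⊗ (q ⊗ (m ⊗ n)) ⊕ conℕ 2 ⊗ (q ⊗ (k ⊗ n)))) refl q (u + n * n) m k n ⟩
  q * (u + n * n) + (2 * (q * (m * n)) + 2 * (q * (k * n)))
    ≤⟨ +-mono-≤ (*-monoʳ-≤ q support≤)
         (+-mono-≤ plotkin≤ (*-monoʳ-≤ 2 (*-monoʳ-≤ q (*-monoˡ-≤ n k≤q)))) ⟩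
  q * (r + q * m) + ((q * u + 2 * (m * n)) + 2 * (q * (q * n)))
    ≡⟨ solveℕ 5 (λ q r m u n → q ⊗ (r ⊕ q ⊗ m) ⊕ ((q ⊗ u ⊕ conℕ 2 ⊗ (m ⊗ n)) ⊕ conℕ 2 ⊗ (q ⊗ (q ⊗ n)))
         ⊜ q ⊗ u ⊕ (q ⊗ r ⊕ (q ⊗ q ⊗ m ⊕ conℕ 2 ⊗ (m ⊗ n) ⊕ conℕ 2 ⊗ (q ⊗ q ⊗ n)))) refl q r m u n ⟩
  q * u + (q * r + (q * q * m + 2 * (m * n) + 2 * (q * q * n)))
    -- The three error terms are at most n², 2n² and 2n², which gives the constant 5.
    ≤⟨ +-monoʳ-≤ (q * u) (+-monoʳ-≤ (q * r)
         (+-mono-≤ (+-mono-≤ (*-mono-≤ qq≤n m≤n′) (*-monoʳ-≤ 2 (*-monoˡ-≤ n m≤n′))) (*-monoʳ-≤ 2 (*-monoˡ-≤ n qq≤n)))) ⟩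
  q * u + (q * r + (n * n + 2 * (n * n) + 2 * (n * n)))
    ≡⟨ solveℕ 3 (λ a b n → a ⊕ (b ⊕ (n ⊗ n ⊕ conℕ 2 ⊗ (n ⊗ n) ⊕ conℕ 2 ⊗ (n ⊗ n)))
         ⊜ a ⊕ (b ⊕ conℕ 5 ⊗ (n ⊗ n))) refl (q * u) (q * r) n ⟩
  q * u + (q * r + 5 * (n * n)) ∎)
  where
  open ≤-Reasoning
  m≤n′ : m ≤ n
  m≤n′ = ≤-trans (m≤m+n m k) (≤-reflexive m+k≡n)

-- As n ≤ s³, e³ n ≤ (s e)³ ≤ c³ n⁶, and one factor n cancels.
cube-bound : ∀ c s e n → .{{NonZero n}} → s * e ≤ c * (n * n) → n ≤ s ^ 3 → e ^ 3 ≤ c ^ 3 * n ^ 5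
cube-bound c s e n se≤ n≤s³ = *-cancelʳ-≤ (e ^ 3) (c ^ 3 * n ^ 5) n (begin
  e ^ 3 * n              ≤⟨ *-monoʳ-≤ (e ^ 3) n≤s³ ⟩
  e ^ 3 * s ^ 3          ≡⟨ solveℕ 2 (λ e s → e ⊛ 3 ⊗ s ⊛ 3 ⊜ (s ⊗ e) ⊛ 3) refl e s ⟩
  (s * e) ^ 3            ≤⟨ ^-monoˡ-≤ 3 se≤ ⟩
  (c * (n * n)) ^ 3      ≡⟨ solveℕ 2 (λ c n → (c ⊗ (n ⊗ n)) ⊛ 3 ⊜ c ⊛ 3 ⊗ n ⊛ 5 ⊗ n) refl c n ⟩
  c ^ 3 * n ^ 5 * n      ∎)
  where open ≤-Reasoning

deficit-bound : ∀ {n r} (μ η : Fin r → LinearForm n) → SpansMatMul n r μ η →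
                ∀ k → 2 ^ k * 2 ^ k ≤ n → 2 ^ k * (3 * n ^ 2 ∸ r) ≤ 5 * (n * n)
deficit-bound {n} {r} μ η spans k qq≤n = conclude
  (rank-bound μ η spans (invertibleMinor _ (generator-independent μ η spans)) k m (≤-reflexive m+k≡n))
  where
  open ≤-Reasoning

  q m : ℕ
  q = 2 ^ k
  m = n ∸ k

  -- The subtraction `n ∸ k` is not truncated, because k ≤ 2ᵏ ≤ 2ᵏ 2ᵏ ≤ n.
  m+k≡n : m + k ≡ n
  m+k≡n = m∸n+n≡m (≤-trans (n≤2^n k) (≤-trans (m≤m*n q q {{m^n≢0 2 k}}) qq≤n))

  conclude : ∃[ u ] (2 * (q * (m * n)) ≤ q * u + 2 * (m * n) × u + n * n ≤ r + q * m) →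
             q * (3 * n ^ 2 ∸ r) ≤ 5 * (n * n)
  conclude (u , plotkin≤ , support≤) = begin
    q * (3 * n ^ 2 ∸ r)        ≡⟨ *-distribˡ-∸ q (3 * n ^ 2) r ⟩
    q * (3 * n ^ 2) ∸ q * r    ≤⟨ m≤n+o⇒m∸n≤o (q * (3 * n ^ 2)) (q * r)
                                    (scaled-deficit q k m n r u (n≤2^n k) qq≤n m+k≡n plotkin≤ support≤) ⟩
    5 * (n * n)                ∎

-- The inequality 3n² - r ≤ C n^{5/3} is cubed to stay within the natural numbers; for r ≥ 3n² the
-- truncated difference is 0.
theorem1 : ∃[ C ] (∀ (n : ℕ) → 1 ≤ n → ∀ (r : ℕ)
    (μ η : Fin r → LinearForm n) → SpansMatMul n r μ η
    → (3 * n ^ 2 ∸ r) ^ 3 ≤ C ^ 3 * n ^ 5)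
-- 10 = 2 · 5: the 5 comes from `deficit-bound`, and the 2 from replacing 2ᵏ by 2ᵏ⁺¹, whose cube is
-- at least n.
theorem1 = 10 , λ n 1≤n r μ η spans → bound n 1≤n r μ η spans (scale n 1≤n)
  where
  open ≤-Reasoning

  bound : ∀ n → 1 ≤ n → ∀ r (μ η : Fin r → LinearForm n) → SpansMatMul n r μ η →
          ∃[ k ] ((2 ^ k) ^ 3 ≤ n × n ≤ (2 ^ suc k) ^ 3) → (3 * n ^ 2 ∸ r) ^ 3 ≤ 10 ^ 3 * n ^ 5
  bound n 1≤n r μ η spans (k , lower , upper) = cube-bound 10 (2 ^ suc k) e n {{>-nonZero 1≤n}} 2qe≤ upper
    where
    q e : ℕ
    q = 2 ^ k
    e = 3 * n ^ 2 ∸ r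

    qq≤n : q * q ≤ n
    qq≤n = begin
      q * q          ≤⟨ m≤n*m (q * q) q {{m^n≢0 2 k}} ⟩
      q * (q * q)    ≡⟨ cong (λ h → q * (q * h)) (*-identityʳ q) ⟨
      q ^ 3          ≤⟨ lower ⟩
      n              ∎

    2qe≤ : 2 * q * e ≤ 10 * (n * n)
    2qe≤ = begin
      2 * q * e            ≡⟨ *-assoc 2 q e ⟩
      2 * (q * e)          ≤⟨ *-monoʳ-≤ 2 (deficit-bound μ η spans k qq≤n) ⟩
      2 * (5 * (n * n))    ≡⟨ *-assoc 2 5 (n * n) ⟨
      10 * (n * n)         ∎
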